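{- Let $n$, $k$ and $\delta$ be positive integers, and let $\mathbb{G}_k(n,\delta)$ be the class of all $k$-connected graphs of order $n$ with minimum degree at least $\delta$. Among all graphs in $\mathbb{G}_k(n,\delta)$, the graph $$M_{n,\delta}=K_k\vee(K_{\delta-k+1}\cup K_{n-\delta-1})$$ is the unique graph with maximum connective eccentricity index.
   Context: All graphs considered are simple and connected (building blocks in a construction may be combined by disjoint union). For a graph $G$ and $v\in V(G)$, $d_G(v)$ is the degree of $v$ and $\varepsilon_G(v)$ is the eccentricity of $v$, i.e. the maximum distance from $v$ to all other vertices of $G$. The connective eccentricity index (CEI) of $G$ is $\xi^{ce}(G)=\sum_{v\in V(G)}\frac{d_G(v)}{\varepsilon_G(v)}$. The connectivity of $G$ is the minimum size of a set $A\subseteq V(G)$ such that $G-A$ is disconnected or has exactly one vertex. A graph is $k$-connected if its connectivity is at least $k$. The minimum degree of $G$ is the smallest degree of a vertex of $G$. $K_m$ is the complete graph on $m$ vertices ($K_0$ being the graph with no vertices), $\cup$ denotes disjoint union, and the join $M_1\vee M_2$ of disjoint graphs $M_1,M_2$ is obtained from $M_1\cup M_2$ by adding all edges $xy$ with $x\in V(M_1)$, $y\in V(M_2)$.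
   Formalization: The class is taken to be graphs of connectivity exactly k (with "at least k" the complete graph K_n would beat M, e.g. n=3, k=δ=1); it is also assumed that k ≤ δ and that the class is non-empty. -}

module Defs where

open import Algebra.Definitions.RawMonoid using () renaming (sum to sumIn)
open import Data.Bool.Base using (Bool; true; false; not)
import Data.Bool.Properties as Bool
open import Data.Fin.Base using (Fin; splitAt)
import Data.Fin.Properties as Fin
open import Data.Fin.Subset using (Subset; _∉_; ∣_∣; ∁)
open import Data.Integer.Base using (+_)
open import Data.Nat.Base using (ℕ; zero; suc; _+_; _∸_; _≤_; _⊔_)
open import Data.Product.Base using (Σ; ∃; ∃₂; _×_; _,_; proj₁)
open import Data.Rational.Base using (ℚ; 0ℚ; _/_; +-0-rawMonoid)
open import Data.Sum.Base using (_⊎_; inj₁; inj₂)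
import Data.Vec.Base as Vec
open import Data.Vec.Functional using (foldr)
open import Function.Base using (_∘_)
open import Function.Bundles using (_↔_; Inverse)
open import Relation.Binary.PropositionalEquality
  using (_≡_; refl; sym; cong)
open import Relation.Nullary.Decidable.Core
  using (Dec; yes; no; does; map′; _×-dec_)
open import Relation.Nullary.Negation.Core using (¬_)
open import Relation.Unary using (Decidable)

-- Simple graphs on an arbitrary vertex type.  A graph of order n is a
-- `Graph (Fin n)`; other vertex types occur as intermediate objects
-- (induced subgraphs, sums).

record Graph (V : Set) : Set where
  field
    adj         : V → V → Bool
    symmetric   : ∀ u v → adj u v ≡ adj v u
    irreflexive : ∀ v → adj v v ≡ false

open Graph public

record _≅_ {V W : Set} (G : Graph V) (H : Graph W) : Set where
  field
    bijection : V ↔ W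
    preserves : ∀ u v →
      adj G u v ≡ adj H (Inverse.to bijection u) (Inverse.to bijection v)

pullback : {V W : Set} → (W → V) → Graph V → Graph W
pullback f G = record
  { adj         = λ u v → adj G (f u) (f v)
  ; symmetric   = λ u v → symmetric G (f u) (f v)
  ; irreflexive = λ v → irreflexive G (f v)
  }

data Walk {V : Set} (G : Graph V) : V → V → ℕ → Set where
  []   : ∀ {v} → Walk G v v 0
  step : ∀ {u v w l} → adj G u v ≡ true → Walk G v w l → Walk G u w (suc l)

Connected : {V : Set} → Graph V → Set
Connected G = ∀ u v → ∃ λ l → Walk G u v l

Disconnected : {V : Set} → Graph V → Set
Disconnected G = ∃₂ λ u v → ∀ l → ¬ Walk G u v l

IsLeast : (ℕ → Set) → ℕ → Set
IsLeast P m = P m × (∀ j → P j → m ≤ j)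

-- Degree and minimum degree

degree : ∀ {n} → Graph (Fin n) → Fin n → ℕ
degree G v = ∣ Vec.tabulate (adj G v) ∣

IsMinDegree : ∀ {n} → Graph (Fin n) → ℕ → Set
IsMinDegree G = IsLeast (λ d → ∃ λ v → degree G v ≡ d)

-- Connectivity

infixl 6 _─_

_─_ : ∀ {n} → Graph (Fin n) → (A : Subset n) → Graph (Σ (Fin n) (_∉ A))
G ─ A = pullback proj₁ G

Separating : ∀ {n} → Graph (Fin n) → Subset n → Set
Separating G A = Disconnected (G ─ A) ⊎ ∣ ∁ A ∣ ≡ 1

IsConnectivity : ∀ {n} → Graph (Fin n) → ℕ → Set
IsConnectivity G = IsLeast (λ s → ∃ λ A → Separating G A × ∣ A ∣ ≡ s)

-- Distance, eccentricity and the connective eccentricity index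

walk? : ∀ {n} (G : Graph (Fin n)) u v → Decidable (Walk G u v)
walk? G u v zero    = map′ (λ { refl → [] }) (λ { [] → refl }) (u Fin.≟ v)
walk? G u v (suc l) = map′
  (λ { (w , e , p) → step e p })
  (λ { (step e p) → _ , e , p })
  (Fin.any? (λ w → (adj G u w Bool.≟ true) ×-dec walk? G w v l))

-- The least number below the bound satisfying P, or the bound itself if
-- there is none.

leastBelow : ℕ → {P : ℕ → Set} → Decidable P → ℕ
leastBelow zero    P? = zero
leastBelow (suc b) P? with P? zero
... | yes _ = zero
... | no  _ = suc (leastBelow b (P? ∘ suc))

-- A shortest walk in a graph of order n has length below n, so for
-- connected graphs this is the usual distance.

distance : ∀ {n} → Graph (Fin n) → Fin n → Fin n → ℕ
distance {n} G u v = leastBelow n (walk? G u v)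

eccentricity : ∀ {n} → Graph (Fin n) → Fin n → ℕ
eccentricity G v = foldr _⊔_ 0 (distance G v)

-- A zero denominator is only met for the graph with a single vertex.

ratio : ℕ → ℕ → ℚ
ratio d zero    = 0ℚ
ratio d (suc e) = + d / suc e

CEI : ∀ {n} → Graph (Fin n) → ℚ
CEI G = sumIn +-0-rawMonoid (λ v → ratio (degree G v) (eccentricity G v))

-- Complete graphs, disjoint unions and joins

complete : ∀ m → Graph (Fin m)
complete m = record
  { adj         = λ u v → not (does (u Fin.≟ v))
  ; symmetric   = λ u v → cong not (≟-sym u v)
  ; irreflexive = ≟-irrefl
  }
  where
  ≟-sym : ∀ u v → does (u Fin.≟ v) ≡ does (v Fin.≟ u)
  ≟-sym u v with u Fin.≟ v | v Fin.≟ u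
  ... | yes _ | yes _ = refl
  ... | no  _ | no  _ = refl
  ... | yes p | no  q with () ← q (sym p)
  ... | no  p | yes q with () ← p (sym q)

  ≟-irrefl : ∀ v → not (does (v Fin.≟ v)) ≡ false
  ≟-irrefl v with v Fin.≟ v
  ... | yes _ = refl
  ... | no  p with () ← p refl

-- G and H side by side, with all cross pairs adjacent (true) or
-- non-adjacent (false).

sumGraph : Bool → {V W : Set} → Graph V → Graph W → Graph (V ⊎ W)
sumGraph c {V} {W} G H = record
  { adj = adj⊎ ; symmetric = symmetric⊎ ; irreflexive = irreflexive⊎ }
  where
  adj⊎ : V ⊎ W → V ⊎ W → Bool
  adj⊎ (inj₁ x) (inj₁ y) = adj G x y
  adj⊎ (inj₂ x) (inj₂ y) = adj H x y
  adj⊎ (inj₁ _) (inj₂ _) = c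
  adj⊎ (inj₂ _) (inj₁ _) = c

  symmetric⊎ : ∀ x y → adj⊎ x y ≡ adj⊎ y x
  symmetric⊎ (inj₁ x) (inj₁ y) = symmetric G x y
  symmetric⊎ (inj₂ x) (inj₂ y) = symmetric H x y
  symmetric⊎ (inj₁ _) (inj₂ _) = refl
  symmetric⊎ (inj₂ _) (inj₁ _) = refl

  irreflexive⊎ : ∀ x → adj⊎ x x ≡ false
  irreflexive⊎ (inj₁ x) = irreflexive G x
  irreflexive⊎ (inj₂ x) = irreflexive H x

infixr 5 _∪_
infixr 4 _∨_

_∪_ : ∀ {m n} → Graph (Fin m) → Graph (Fin n) → Graph (Fin (m + n))
_∪_ {m} G H = pullback (splitAt m) (sumGraph false G H)

_∨_ : ∀ {m n} → Graph (Fin m) → Graph (Fin n) → Graph (Fin (m + n))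
_∨_ {m} G H = pullback (splitAt m) (sumGraph true G H)

-- `suc δ ∸ k` and `n ∸ suc δ` are δ − k + 1 and n − δ − 1; the order is n
-- when k ≤ δ + 1 and δ + 1 ≤ n.

M : ∀ n k δ → Graph (Fin (k + ((suc δ ∸ k) + (n ∸ suc δ))))
M n k δ = complete k ∨ (complete (suc δ ∸ k) ∪ complete (n ∸ suc δ))

-- The connectivity is k exactly.  If it were only bounded below by k, the
-- complete graph of order n would belong to every class with k, δ < n and,
-- having the largest CEI of all, would be the extremal graph instead of M.

record 𝔾 (n k δ : ℕ) {m : ℕ} (G : Graph (Fin m)) : Set where
  field
    order        : m ≡ n
    connected    : Connected G
    connectivity : IsConnectivity G k
    minDegree    : ∃ λ d → IsMinDegree G d × δ ≤ d

{-# OPTIONS --safe #-}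

-- A separating k-set of G colours its vertices hub (the set itself), left and right, with no edge
-- between left and right.  Hence a hub contributes at most n − 1 to the index, and a vertex of a
-- side of size s at most (k + s − 1) / 2, because its eccentricity is at least 2; the sum of these
-- bounds is attained exactly when every edge allowed by the colouring is present.  The minimum
-- degree forces both sides to have at least δ − k + 1 vertices, and for sizes a + x and a + y the
-- bound falls short of that for a and a + x + y by xy, which vanishes only if x = 0 or y = 0.
-- If n ≤ k + 1 instead, the minimum degree makes every graph of the class complete.
module Submission where

open import Defs
open import Data.Bool.Base using (Bool; true; false) renaming (_∨_ to _or_)
import Data.Bool.Properties as Bool
open import Data.Fin.Base using (Fin; zero; suc; punchIn; splitAt)
open import Data.Fin.Permutation using (Permutation; _⟨$⟩ʳ_; insert; insert-punchIn)
import Data.Fin.Permutation as Perm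
open import Data.Fin.Properties using (_≟_; any?; punchInᵢ≢i; splitAt⁻¹-↑ˡ; splitAt⁻¹-↑ʳ)
open import Data.Fin.Subset using (Subset; _∈_; _∉_; ∣_∣; ∁; ⁅_⁆; _⊆_; _⊃_)
  renaming (_∪_ to _⊔ˢ_)
open import Data.Fin.Subset.Induction using (⊃-wellFounded; Acc; acc)
open import Data.Fin.Subset.Properties
  using (_∈?_; ∣∁p∣≡n∸∣p∣; x∈⁅x⁆; x∈⁅y⁆⇒x≡y; p⊆p∪q; q⊆p∪q; x∈p∪q⁻)
import Data.Integer.Base as ℤ
import Data.Integer.Properties as ℤ
open import Data.Nat.Base using (ℕ; zero; suc; pred; _+_; _*_; _∸_; _≤_; _<_; z≤n; s≤s; s≤s⁻¹; _⊔_)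
open import Data.Nat.Properties hiding (_≟_)
open import Data.Nat.Solver using (module +-*-Solver)
open import Data.Product.Base using (∃; ∃₂; _×_; _,_; proj₁; proj₂)
import Data.Rational.Base as ℚ
import Data.Rational.Properties as ℚ
import Data.Rational.Unnormalised.Base as ℚᵘ
import Data.Rational.Unnormalised.Properties as ℚᵘ
open import Data.Sum.Base using (_⊎_; inj₁; inj₂; [_,_]′; map₁)
import Data.Vec.Base as Vec
import Data.Vec.Functional as Vector
open import Data.Vec.Properties using ([]=⇒lookup; lookup⇒[]=; lookup∘tabulate; tabulate∘lookup)
open import Function.Base using (_∘_; id; const)
open import Function.Bundles using (Injection)
open import Function.Properties.Inverse using (↔⇒↣)
open import Relation.Binary.PropositionalEquality
  using (_≡_; _≢_; refl; sym; trans; cong; cong₂; subst; subst₂; module ≡-Reasoning)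
open import Relation.Nullary.Decidable
  using (Dec; yes; no; does; ¬?; _×-dec_; dec-true; dec-false; decidable-stable)
open import Relation.Nullary.Negation using (¬_; contradiction)
open import Relation.Unary using (Decidable)
open import Algebra.Properties.CommutativeMonoid.Sum +-0-commutativeMonoid
  using (sum; sum-remove; sum-cong-≗)
module ℚΣ where
  open import Algebra.Properties.CommutativeMonoid.Sum ℚ.+-0-commutativeMonoid public

-- Sums

-- Abstract in the ordered monoid because the argument is needed twice: over ℚ to recover degrees
-- from the index, and over ℕ to recover edges from degrees.
module Monotone {A : Set} (_∙_ : A → A → A) (ε : A) (_≼_ _≺_ : A → A → Set)
  (≼-refl : ∀ {x} → x ≼ x)
  (≼-antisym : ∀ {x y} → x ≼ y → y ≼ x → x ≡ y)
  (≺-irrefl : ∀ {x y} → x ≡ y → ¬ x ≺ y)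
  (⊀⇒≽ : ∀ {x y} → ¬ x ≺ y → y ≼ x)
  (∙-mono : ∀ {w x y z} → w ≼ x → y ≼ z → (w ∙ y) ≼ (x ∙ z))
  (∙-mono-≺-≼ : ∀ {w x y z} → w ≺ x → y ≼ z → (w ∙ y) ≺ (x ∙ z))
  (∙-mono-≼-≺ : ∀ {w x y z} → w ≼ x → y ≺ z → (w ∙ y) ≺ (x ∙ z))
  where

  total : ∀ {n} → (Fin n → A) → A
  total = Vector.foldr _∙_ ε

  total-mono : ∀ {n} {f g : Fin n → A} → (∀ i → f i ≼ g i) → total f ≼ total g
  total-mono {zero}  f≼g = ≼-refl
  total-mono {suc n} f≼g = ∙-mono (f≼g zero) (total-mono (f≼g ∘ suc))

  -- The source of all equality cases: a strict inequality in a single term would make the totals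
  -- differ.
  total-rigid : ∀ {n} {f g : Fin n → A} → (∀ i → f i ≼ g i) →
                total f ≡ total g → ∀ i → f i ≡ g i
  total-rigid f≼g eq zero = ≼-antisym (f≼g zero)
    (⊀⇒≽ λ f₀≺g₀ → ≺-irrefl eq (∙-mono-≺-≼ f₀≺g₀ (total-mono (f≼g ∘ suc))))
  total-rigid f≼g eq (suc i) = total-rigid (f≼g ∘ suc) (≼-antisym (total-mono (f≼g ∘ suc))
    (⊀⇒≽ λ fs≺gs → ≺-irrefl eq (∙-mono-≼-≺ (f≼g zero) fs≺gs))) i

open Monotone _+_ 0 _≤_ _<_ ≤-refl ≤-antisym <-irrefl ≮⇒≥ +-mono-≤ +-mono-<-≤ +-mono-≤-<
  using () renaming (total-mono to sum-mono; total-rigid to sum-rigid)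

open Monotone ℚ._+_ ℚ.0ℚ ℚ._≤_ ℚ._<_ ℚ.≤-refl ℚ.≤-antisym ℚ.<-irrefl ℚ.≮⇒≥
  ℚ.+-mono-≤ ℚ.+-mono-<-≤ ℚ.+-mono-≤-<
  using () renaming (total-mono to ℚsum-mono; total-rigid to ℚsum-rigid)

sum-const : ∀ n x → sum {n} (const x) ≡ n * x
sum-const zero    x = refl
sum-const (suc n) x = cong (x +_) (sum-const n x)

sum-1 : ∀ n → sum {n} (const 1) ≡ n
sum-1 n = trans (sum-const n 1) (*-identityʳ n)

term≤sum : ∀ {n} (f : Fin n → ℕ) i → f i ≤ sum f
term≤sum {suc n} f i rewrite sum-remove {i = i} f = m≤m+n (f i) _

sum-increment : ∀ {n} {f g : Fin n → ℕ} v → suc (f v) ≡ g v → (∀ w → w ≢ v → f w ≡ g w) →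
                suc (sum f) ≡ sum g
sum-increment {suc n} {f} {g} v eq same
  rewrite sum-remove {i = v} f | sum-remove {i = v} g =
  cong₂ _+_ eq (sum-cong-≗ (λ i → same (punchIn v i) (punchInᵢ≢i v i)))

sum-splitAt : ∀ m {n} (f : Fin m ⊎ Fin n → ℕ) →
              sum (f ∘ splitAt m) ≡ sum (f ∘ inj₁) + sum (f ∘ inj₂)
sum-splitAt zero    f = refl
sum-splitAt (suc m) f = trans
  (cong (f (inj₁ zero) +_) (sum-splitAt m (f ∘ map₁ suc)))
  (sym (+-assoc (f (inj₁ zero)) _ _))

-- Indicators and cardinalities of subsets

ind : Bool → ℕ
ind true  = 1
ind false = 0

ind-injective : ∀ {x y} → ind x ≡ ind y → x ≡ y
ind-injective {true}  {true}  _ = refl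
ind-injective {false} {false} _ = refl

ind-mono : ∀ {x y} → (x ≡ true → y ≡ true) → ind x ≤ ind y
ind-mono {false} _ = z≤n
ind-mono {true}  h rewrite h refl = ≤-refl

∣tabulate∣≡sum : ∀ {n} (f : Fin n → Bool) → ∣ Vec.tabulate f ∣ ≡ sum (ind ∘ f)
∣tabulate∣≡sum {zero}  f = refl
∣tabulate∣≡sum {suc n} f with f zero
... | true  = cong suc (∣tabulate∣≡sum (f ∘ suc))
... | false = ∣tabulate∣≡sum (f ∘ suc)

∣p∣≡sum : ∀ {n} (p : Subset n) → ∣ p ∣ ≡ sum (ind ∘ Vec.lookup p)
∣p∣≡sum p = trans (cong ∣_∣ (sym (tabulate∘lookup p))) (∣tabulate∣≡sum (Vec.lookup p))

∉⇒lookup≡false : ∀ {n} {p : Subset n} {x} → x ∉ p → Vec.lookup p x ≡ false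
∉⇒lookup≡false {p = p} {x} x∉p with Vec.lookup p x in eq
... | true  = contradiction (lookup⇒[]= x p eq) x∉p
... | false = refl

lookup≡false⇒∉ : ∀ {n} {p : Subset n} {x} → Vec.lookup p x ≡ false → x ∉ p
lookup≡false⇒∉ eq x∈p with () ← trans (sym eq) ([]=⇒lookup x∈p)

n≤1+∣p∣ : ∀ {n} {p : Subset n} h → (∀ y → y ≢ h → y ∈ p) → n ≤ suc ∣ p ∣
n≤1+∣p∣ {suc n} {p} h all∈p
  rewrite ∣p∣≡sum p | sum-remove {i = h} (ind ∘ Vec.lookup p) = s≤s (begin
  n                                                 ≡⟨ sum-1 n ⟨
  sum {n} (const 1)                                 ≡⟨ sum-cong-≗ (λ i → cong ind ([]=⇒lookup (all∈p _ (punchInᵢ≢i h i)))) ⟨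
  sum (λ i → ind (Vec.lookup p (punchIn h i)))      ≤⟨ m≤n+m _ (ind (Vec.lookup p h)) ⟩
  ind (Vec.lookup p h) + sum (λ i → ind (Vec.lookup p (punchIn h i))) ∎)
  where open ≤-Reasoning

-- Rational summands

-- `ratio` reduces to lowest terms; passing to unnormalised rationals leaves plain
-- cross-multiplication.
ratio-≤ : ∀ {d e d′ e′} → d * suc e′ ≤ d′ * suc e → ratio d (suc e) ℚ.≤ ratio d′ (suc e′)
ratio-≤ {d} {e} {d′} {e′} le = ℚ.toℚᵘ-cancel-≤
  (ℚᵘ.≤-respˡ-≃ (ℚᵘ.≃-sym (ℚ.toℚᵘ-fromℚᵘ (ℚᵘ.mkℚᵘ (ℤ.+ d) e)))
  (ℚᵘ.≤-respʳ-≃ (ℚᵘ.≃-sym (ℚ.toℚᵘ-fromℚᵘ (ℚᵘ.mkℚᵘ (ℤ.+ d′) e′)))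
  (ℚᵘ.*≤* le′)))
  where
  le′ : ℤ.+ d ℤ.* ℤ.+ suc e′ ℤ.≤ ℤ.+ d′ ℤ.* ℤ.+ suc e
  le′ rewrite sym (ℤ.pos-* d (suc e′)) | sym (ℤ.pos-* d′ (suc e)) = ℤ.+≤+ le

ratio-injective : ∀ {d e d′ e′} → ratio d (suc e) ≡ ratio d′ (suc e′) → d * suc e′ ≡ d′ * suc e
ratio-injective {d} {e} {d′} {e′} eq
  with ℚᵘ.*≡* eq′ ← ℚ.fromℚᵘ-injective {ℚᵘ.mkℚᵘ (ℤ.+ d) e} {ℚᵘ.mkℚᵘ (ℤ.+ d′) e′} eq =
  ℤ.+-injective (trans (ℤ.pos-* d (suc e′)) (trans eq′ (sym (ℤ.pos-* d′ (suc e)))))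

ratio-≡ : ∀ {d e d′ e′} → d * suc e′ ≡ d′ * suc e → ratio d (suc e) ≡ ratio d′ (suc e′)
ratio-≡ {d} {e} {d′} {e′} eq =
  ℚ.≤-antisym (ratio-≤ {d} {e} {d′} {e′} (≤-reflexive eq))
              (ratio-≤ {d′} {e′} {d} {e} (≤-reflexive (sym eq)))

ratio-mono : ∀ {d e d′ e′} → d ≤ d′ → 1 ≤ e′ → e′ ≤ e → ratio d e ℚ.≤ ratio d′ e′
ratio-mono {d} {suc e} {d′} {suc e′} d≤d′ _ e′≤e = ratio-≤ {d} {e} {d′} {e′} (*-mono-≤ d≤d′ e′≤e)

-- The chain d · e′ ≤ d′ · e′ ≤ d′ · e = d · e′ collapses, and e′ is cancelled. Only numerators are
-- recovered, since denominators may differ when both numerators vanish; degrees are enough for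
-- saturation.
ratio-rigid : ∀ {d e d′ e′} → d ≤ d′ → 1 ≤ e′ → e′ ≤ e → ratio d e ≡ ratio d′ e′ → d ≡ d′
ratio-rigid {d} {suc e} {d′} {suc e′} d≤d′ _ e′≤e eq = *-cancelʳ-≡ d d′ (suc e′)
  (≤-antisym (*-monoˡ-≤ (suc e′) d≤d′)
    (≤-trans (*-monoʳ-≤ d′ e′≤e) (≤-reflexive (sym (ratio-injective {d} {e} {d′} {e′} eq)))))

half : ℕ → ℚ.ℚ
half m = ratio m 2

half-mono : ∀ {m n} → m ≤ n → half m ℚ.≤ half n
half-mono {m} {n} m≤n = ratio-≤ {m} {1} {n} {1} (*-monoˡ-≤ 2 m≤n)

half-injective : ∀ {m n} → half m ≡ half n → m ≡ n
half-injective {m} {n} eq = *-cancelʳ-≡ m n 2 (ratio-injective {m} {1} {n} {1} eq)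

half-+ : ∀ m n → half (m + n) ≡ half m ℚ.+ half n
half-+ m n = ℚ.toℚᵘ-injective (begin
  ℚ.toℚᵘ (half (m + n))                                ≈⟨ ℚ.toℚᵘ-fromℚᵘ (over2 (m + n)) ⟩
  over2 (m + n)                                        ≈⟨ ℚᵘ.*≡* crossed ⟩
  over2 m ℚᵘ.+ over2 n                                 ≈⟨ ℚᵘ.+-cong (ℚ.toℚᵘ-fromℚᵘ (over2 m)) (ℚ.toℚᵘ-fromℚᵘ (over2 n)) ⟨
  ℚ.toℚᵘ (half m) ℚᵘ.+ ℚ.toℚᵘ (half n)                 ≈⟨ ℚ.toℚᵘ-homo-+ (half m) (half n) ⟨
  ℚ.toℚᵘ (half m ℚ.+ half n)                           ∎)
  where
  open ℚᵘ.≃-Reasoning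
  over2 : ℕ → ℚᵘ.ℚᵘ
  over2 i = ℚᵘ.mkℚᵘ (ℤ.+ i) 1
  -- The 4 is the product of the two denominators, which unnormalised addition does not reduce.
  crossed : ℤ.+ (m + n) ℤ.* ℤ.+ 4 ≡ (ℤ.+ m ℤ.* ℤ.+ 2 ℤ.+ ℤ.+ n ℤ.* ℤ.+ 2) ℤ.* ℤ.+ 2
  crossed rewrite sym (ℤ.pos-* m 2) | sym (ℤ.pos-* n 2) | sym (ℤ.pos-* (m + n) 4)
    | sym (ℤ.pos-* (m * 2 + n * 2) 2) = cong ℤ.+_
    (solve 2 (λ m n → (m :+ n) :* con 4 := (m :* con 2 :+ n :* con 2) :* con 2) refl m n)
    where open +-*-Solver

half-sum : ∀ {n} (f : Fin n → ℕ) → ℚΣ.sum (half ∘ f) ≡ half (sum f)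
half-sum {zero}  f = refl
half-sum {suc n} f = trans (cong (half (f zero) ℚ.+_) (half-sum (f ∘ suc)))
                           (sym (half-+ (f zero) (sum (f ∘ suc))))

-- Eccentricities

leastBelow-≤ : ∀ b {P : ℕ → Set} (P? : Decidable P) {l} → P l → leastBelow b P? ≤ l
leastBelow-≤ zero    P? p = z≤n
leastBelow-≤ (suc b) P? p with P? zero
... | yes _ = z≤n
leastBelow-≤ (suc b) P? {zero}  p | no ¬p₀ = contradiction p ¬p₀
leastBelow-≤ (suc b) P? {suc l} p | no _   = s≤s (leastBelow-≤ b (P? ∘ suc) p)

-- `j ≤ b` covers the default: `leastBelow` returns `b` when the search fails.
≤-leastBelow : ∀ b {P : ℕ → Set} (P? : Decidable P) {j} → j ≤ b → (∀ i → i < j → ¬ P i) →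
               j ≤ leastBelow b P?
≤-leastBelow b       P? {zero}  j≤b ¬P = z≤n
≤-leastBelow (suc b) P? {suc j} (s≤s j≤b) ¬P with P? zero
... | yes p = contradiction p (¬P zero (s≤s z≤n))
... | no  _ = s≤s (≤-leastBelow b (P? ∘ suc) j≤b (λ i i<j → ¬P (suc i) (s≤s i<j)))

≤-maximum : ∀ {n} (f : Fin n → ℕ) i → f i ≤ Vector.foldr _⊔_ 0 f
≤-maximum f zero    = m≤m⊔n (f zero) _
≤-maximum f (suc i) = ≤-trans (≤-maximum (f ∘ suc) i) (m≤n⊔m (f zero) _)

maximum-≤ : ∀ {n} (f : Fin n → ℕ) {b} → (∀ i → f i ≤ b) → Vector.foldr _⊔_ 0 f ≤ b
maximum-≤ {zero}  f f≤b = z≤n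
maximum-≤ {suc n} f f≤b = ⊔-lub (f≤b zero) (maximum-≤ (f ∘ suc) (f≤b ∘ suc))

2≤order : ∀ {n} {v w : Fin n} → v ≢ w → 2 ≤ n
2≤order {v = zero}      {zero}      v≢w = contradiction refl v≢w
2≤order {v = zero}      {suc zero}    _ = s≤s (s≤s z≤n)
2≤order {v = zero}      {suc (suc _)} _ = s≤s (s≤s z≤n)
2≤order {v = suc zero}    {_} _ = s≤s (s≤s z≤n)
2≤order {v = suc (suc _)} {_} _ = s≤s (s≤s z≤n)

-- The diagonal counts as adjacent so that it agrees with `link p p`; sums over all vertices then
-- need no exception at the vertex itself.
closed : ∀ {n} → Graph (Fin n) → Fin n → Fin n → Bool
closed G u v = does (u ≟ v) or adj G u v

closed-≢ : ∀ {n} (G : Graph (Fin n)) {u v} → u ≢ v → closed G u v ≡ adj G u v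
closed-≢ G {u} {v} u≢v rewrite dec-false (u ≟ v) u≢v = refl

closed-refl : ∀ {n} (G : Graph (Fin n)) v → closed G v v ≡ true
closed-refl G v rewrite dec-true (v ≟ v) refl = refl

adj⇒≢ : ∀ {V : Set} (G : Graph V) {u v} → adj G u v ≡ true → u ≢ v
adj⇒≢ G e refl with () ← trans (sym e) (irreflexive G _)

suc-degree : ∀ {n} (G : Graph (Fin n)) v → suc (degree G v) ≡ sum (ind ∘ closed G v)
suc-degree G v rewrite ∣tabulate∣≡sum (adj G v) = sum-increment v self others
  where
  self : suc (ind (adj G v v)) ≡ ind (closed G v v)
  self = trans (cong (suc ∘ ind) (irreflexive G v)) (cong ind (sym (closed-refl G v)))
  others : ∀ w → w ≢ v → ind (adj G v w) ≡ ind (closed G v w)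
  others w w≢v = cong ind (sym (closed-≢ G (w≢v ∘ sym)))

≤-eccentricity : ∀ {n} (G : Graph (Fin n)) {v} w {j} → j ≤ n → (∀ i → i < j → ¬ Walk G v w i) →
                 j ≤ eccentricity G v
≤-eccentricity {n} G {v} w j≤n none =
  ≤-trans (≤-leastBelow n (walk? G v w) j≤n none) (≤-maximum (distance G v) w)

1≤eccentricity : ∀ {n} (G : Graph (Fin n)) {v w} → v ≢ w → 1 ≤ eccentricity G v
1≤eccentricity G {v} {w} v≢w =
  ≤-eccentricity G w (≤-trans (s≤s z≤n) (2≤order v≢w)) λ { zero _ [] → v≢w refl ; (suc _) (s≤s ()) _ }

-- A walk of length 0 would identify the two vertices, and one of length 1 would be an edge between
-- them.
2≤eccentricity : ∀ {n} (G : Graph (Fin n)) {v w} → closed G v w ≡ false → 2 ≤ eccentricity G v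
2≤eccentricity G {v} {w} apart = ≤-eccentricity G w (2≤order v≢w) none
  where
  v≢w : v ≢ w
  v≢w refl with () ← trans (sym apart) (closed-refl G v)
  none : ∀ i → i < 2 → ¬ Walk G v w i
  none zero _ [] = v≢w refl
  none (suc zero) _ (step e []) with () ← trans (sym e) (trans (sym (closed-≢ G v≢w)) apart)
  none (suc (suc _)) (s≤s (s≤s ())) _

eccentricity-≤ : ∀ {n} (G : Graph (Fin n)) {v b} → (∀ w → ∃ λ l → Walk G v w l × l ≤ b) →
                 eccentricity G v ≤ b
eccentricity-≤ {n} G {v} near = maximum-≤ (distance G v) λ w →
  let (l , p , l≤b) = near w in ≤-trans (leastBelow-≤ n (walk? G v w) p) l≤b

-- Colourings by hub, left and right

data Part : Set where
  hub left right : Part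

link : Part → Part → Bool
link left  right = false
link right left  = false
link hub   _     = true
link left  hub   = true
link left  left  = true
link right hub   = true
link right right = true

link-hubʳ : ∀ p → link p hub ≡ true
link-hubʳ hub   = refl
link-hubʳ left  = refl
link-hubʳ right = refl

link-refl : ∀ p → link p p ≡ true
link-refl hub   = refl
link-refl left  = refl
link-refl right = refl

infix 4 _≟ᴾ_

_≟ᴾ_ : (p q : Part) → Dec (p ≡ q)
hub   ≟ᴾ hub   = yes refl
hub   ≟ᴾ left  = no λ ()
hub   ≟ᴾ right = no λ ()
left  ≟ᴾ hub   = no λ ()
left  ≟ᴾ left  = yes refl
left  ≟ᴾ right = no λ ()
right ≟ᴾ hub   = no λ ()
right ≟ᴾ left  = no λ ()
right ≟ᴾ right = yes refl

is : Part → Part → ℕ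
is p q = ind (does (p ≟ᴾ q))

is-refl : ∀ p → is p p ≡ 1
is-refl hub   = refl
is-refl left  = refl
is-refl right = refl

-- The total weight of k hubs, a left and c right vertices when the weight depends on the colour
-- alone.
combine : ℕ → ℕ → ℕ → (Part → ℕ) → ℕ
combine k a c f = k * f hub + (a * f left + c * f right)

combine-left-suc : ∀ k a c f → f left + combine k a c f ≡ combine k (suc a) c f
combine-left-suc k a c f = solve 6
  (λ k a c x y z → y :+ (k :* x :+ (a :* y :+ c :* z)) := k :* x :+ ((con 1 :+ a) :* y :+ c :* z))
  refl k a c (f hub) (f left) (f right)
  where open +-*-Solver

combine-right-suc : ∀ k a c f → f right + combine k a c f ≡ combine k a (suc c) f
combine-right-suc k a c f = solve 6
  (λ k a c x y z → z :+ (k :* x :+ (a :* y :+ c :* z)) := k :* x :+ (a :* y :+ (con 1 :+ c) :* z))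
  refl k a c (f hub) (f left) (f right)
  where open +-*-Solver

-- Stated for all weights f, so that counts of colours, degrees and bounds are all instances.
record HasSizes {n} (χ : Fin n → Part) (k a c : ℕ) : Set where
  constructor sized
  field sum-colours : ∀ f → sum (f ∘ χ) ≡ combine k a c f

open HasSizes

hasSizes : ∀ {n} (χ : Fin n → Part) →
           HasSizes χ (sum (is hub ∘ χ)) (sum (is left ∘ χ)) (sum (is right ∘ χ))
hasSizes {zero}  χ = sized λ f → refl
hasSizes {suc n} χ = sized λ f → trans (cong (f (χ zero) +_) (sum-colours (hasSizes (χ ∘ suc)) f)) (add f)
  where
  h = sum (is hub ∘ χ ∘ suc)
  l = sum (is left ∘ χ ∘ suc)
  r = sum (is right ∘ χ ∘ suc)
  add : ∀ f → f (χ zero) + combine h l r f ≡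
              combine (is hub (χ zero) + h) (is left (χ zero) + l) (is right (χ zero) + r) f
  add f with χ zero
  ... | hub   = sym (+-assoc (f hub) _ _)
  ... | left  = combine-left-suc h l r f
  ... | right = combine-right-suc h l r f

occurs : ∀ {n} (χ : Fin n → Part) p → 1 ≤ sum (is p ∘ χ) → ∃ λ v → χ v ≡ p
occurs {n} χ p pos with any? (λ v → χ v ≟ᴾ p)
... | yes found = found
... | no  none  = contradiction pos (<⇒≱ (s≤s (≤-reflexive
  (trans (sum-cong-≗ λ v → cong ind (dec-false (p ≟ᴾ χ v) (λ eq → none (v , sym eq)))) (trans (sum-const n 0) (*-zeroʳ n))))))

occurs⇒1≤ : ∀ {n} (χ : Fin n → Part) {p} v → χ v ≡ p → 1 ≤ sum (is p ∘ χ)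
occurs⇒1≤ χ v refl = subst (_≤ sum (is (χ v) ∘ χ)) (is-refl (χ v)) (term≤sum (is (χ v) ∘ χ) v)

combine-hub : ∀ k a c → combine k a c (is hub) ≡ k
combine-hub = solve 3 (λ k a c → k :* con 1 :+ (a :* con 0 :+ c :* con 0) := k) refl
  where open +-*-Solver

combine-left : ∀ k a c → combine k a c (is left) ≡ a
combine-left = solve 3 (λ k a c → k :* con 0 :+ (a :* con 1 :+ c :* con 0) := a) refl
  where open +-*-Solver

combine-right : ∀ k a c → combine k a c (is right) ≡ c
combine-right = solve 3 (λ k a c → k :* con 0 :+ (a :* con 0 :+ c :* con 1) := c) refl
  where open +-*-Solver

combine-1 : ∀ k a c → combine k a c (const 1) ≡ k + (a + c)
combine-1 = solve 3 (λ k a c → k :* con 1 :+ (a :* con 1 :+ c :* con 1) := k :+ (a :+ c)) refl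
  where open +-*-Solver

HasSizes⇒order : ∀ {n} {χ : Fin n → Part} {k a c} → HasSizes χ k a c → n ≡ k + (a + c)
HasSizes⇒order {n} {k = k} {a} {c} sizes = trans (sym (sum-1 n)) (trans (sum-colours sizes (const 1)) (combine-1 k a c))

module _ {n} {χ : Fin n → Part} {k a c} (sizes : HasSizes χ k a c) where

  1≤right : ∀ {v} → χ v ≡ right → 1 ≤ c
  1≤right {v} χv = subst (1 ≤_) (trans (sum-colours sizes (is right)) (combine-right k a c)) (occurs⇒1≤ χ v χv)

  hub-occurs : 1 ≤ k → ∃ λ v → χ v ≡ hub
  hub-occurs 1≤k = occurs χ hub (subst (1 ≤_) (sym (trans (sum-colours sizes (is hub)) (combine-hub k a c))) 1≤k)

  left-occurs : 1 ≤ a → ∃ λ v → χ v ≡ left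
  left-occurs 1≤a = occurs χ left (subst (1 ≤_) (sym (trans (sum-colours sizes (is left)) (combine-left k a c))) 1≤a)

  right-occurs : 1 ≤ c → ∃ λ v → χ v ≡ right
  right-occurs 1≤c = occurs χ right (subst (1 ≤_) (sym (trans (sum-colours sizes (is right)) (combine-right k a c))) 1≤c)

-- A permutation matching the colours exists because the sum of the indicator of a
-- colour counts its occurrences.
colour-permutation : ∀ {m n} (χ : Fin m → Part) (η : Fin n → Part) →
  (∀ f → sum (f ∘ χ) ≡ sum (f ∘ η)) →
  ∃ λ (π : Permutation m n) → ∀ v → η (π ⟨$⟩ʳ v) ≡ χ v
colour-permutation {zero} {n} χ η same with trans (same (const 1)) (sum-1 n)
... | refl = Perm.id , λ ()
colour-permutation {suc m} {zero} χ η same with () ← same (const 1)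
colour-permutation {suc m} {suc n} χ η same
  with j , ηj ← occurs η (χ zero) (subst (1 ≤_) (same (is (χ zero))) (occurs⇒1≤ χ zero refl))
  with π , match ← colour-permutation (χ ∘ suc) (η ∘ punchIn j) (λ f →
    +-cancelˡ-≡ (f (χ zero)) _ _ (trans (same f)
      (trans (sum-remove {i = j} (f ∘ η)) (cong (λ p → f p + sum (f ∘ η ∘ punchIn j)) ηj)))) =
  insert zero j π , λ where
    zero    → ηj
    (suc v) → trans (cong η (insert-punchIn zero j π v)) (match v)

-- Coloured graphs

Respects : ∀ {n} → Graph (Fin n) → (Fin n → Part) → Set
Respects G χ = ∀ u v → adj G u v ≡ true → link (χ u) (χ v) ≡ true

-- Up to isomorphism such a graph is the join of a clique on the hubs with two disjoint cliques on
-- the sides.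
Saturated : ∀ {n} → Graph (Fin n) → (Fin n → Part) → Set
Saturated G χ = ∀ u v → closed G u v ≡ link (χ u) (χ v)

closed⇒link : ∀ {n} {G : Graph (Fin n)} {χ} → Respects G χ → ∀ u v →
              closed G u v ≡ true → link (χ u) (χ v) ≡ true
closed⇒link {χ = χ} resp u v eq with u ≟ v
... | yes refl = link-refl (χ u)
... | no  _    = resp u v eq

Saturated⇒adj : ∀ {n} {G : Graph (Fin n)} {χ} → Saturated G χ → ∀ {u v} → u ≢ v →
                adj G u v ≡ link (χ u) (χ v)
Saturated⇒adj {G = G} sat u≢v = trans (sym (closed-≢ G u≢v)) (sat _ _)

Saturated⇒Respects : ∀ {n} {G : Graph (Fin n)} {χ} → Saturated G χ → Respects G χ
Saturated⇒Respects {G = G} sat u v e = trans (sym (Saturated⇒adj {G = G} sat (adj⇒≢ G e))) e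

-- In a saturated graph the colours of two distinct vertices decide their adjacency, so a
-- colour-preserving bijection is an isomorphism.
Saturated⇒≅ : ∀ {m n} {G : Graph (Fin m)} {H : Graph (Fin n)} {χ η} →
  Saturated G χ → Saturated H η → (∀ f → sum (f ∘ χ) ≡ sum (f ∘ η)) → G ≅ H
Saturated⇒≅ {G = G} {H} {χ} {η} satG satH same with colour-permutation χ η same
... | π , match = record { bijection = π ; preserves = preserves }
  where
  preserves : ∀ u v → adj G u v ≡ adj H (π ⟨$⟩ʳ u) (π ⟨$⟩ʳ v)
  preserves u v with u ≟ v
  ... | yes refl = trans (irreflexive G u) (sym (irreflexive H _))
  ... | no  u≢v  = trans (Saturated⇒adj {G = G} satG u≢v) (trans
    (sym (cong₂ link (match u) (match v)))
    (sym (Saturated⇒adj {G = H} satH (u≢v ∘ Injection.injective (↔⇒↣ π)))))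

-- The largest possible order of the closed neighbourhood of a vertex of the given colour.
reach : ℕ → ℕ → ℕ → Part → ℕ
reach k a c p = combine k a c (ind ∘ link p)

reach-left : ∀ k a c → reach k a c left ≡ k + a
reach-left = solve 3 (λ k a c → k :* con 1 :+ (a :* con 1 :+ c :* con 0) := k :+ a) refl
  where open +-*-Solver

reach-right : ∀ k a c → reach k a c right ≡ k + c
reach-right = solve 3 (λ k a c → k :* con 1 :+ (a :* con 0 :+ c :* con 1) := k :+ c) refl
  where open +-*-Solver

-- The eccentricity by colour in a saturated graph in which all three colours occur.
radius : Part → ℕ
radius hub   = 1
radius left  = 2
radius right = 2

-- Equal to 2 / `radius`, the factor that brings every summand to denominator 2.
coradius : Part → ℕ
coradius hub   = 2
coradius left  = 1
coradius right = 1

1≤radius : ∀ p → 1 ≤ radius p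
1≤radius hub   = s≤s z≤n
1≤radius left  = s≤s z≤n
1≤radius right = s≤s z≤n

ratio-radius : ∀ d p → ratio d (radius p) ≡ half (d * coradius p)
ratio-radius d hub   = ratio-≡ {d} {0} {d * 2} {1} (sym (*-identityʳ (d * 2)))
ratio-radius d left  = cong half (sym (*-identityʳ d))
ratio-radius d right = cong half (sym (*-identityʳ d))

-- Doubled, so that the comparison of bounds takes place in ℕ.
weight : ℕ → ℕ → ℕ → Part → ℕ
weight k a c p = pred (reach k a c p) * coradius p

-- Twice the index of a saturated graph of these sizes whose eccentricities are given by `radius`.
bound : ℕ → ℕ → ℕ → ℕ
bound k a c = combine k a c (weight k a c)

module _ {n} {G : Graph (Fin n)} {χ : Fin n → Part} {k a c} (sizes : HasSizes χ k a c) where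

  Respects⇒degree≤ : Respects G χ → ∀ v → suc (degree G v) ≤ reach k a c (χ v)
  Respects⇒degree≤ resp v = begin
    suc (degree G v)                   ≡⟨ suc-degree G v ⟩
    sum (ind ∘ closed G v)             ≤⟨ sum-mono (λ w → ind-mono (closed⇒link {G = G} resp v w)) ⟩
    sum (ind ∘ link (χ v) ∘ χ)         ≡⟨ sum-colours sizes (ind ∘ link (χ v)) ⟩
    reach k a c (χ v)                  ∎
    where open ≤-Reasoning

  Saturated⇒degree≡ : Saturated G χ → ∀ v → suc (degree G v) ≡ reach k a c (χ v)
  Saturated⇒degree≡ sat v = trans (suc-degree G v)
    (trans (sum-cong-≗ (λ w → cong ind (sat v w))) (sum-colours sizes (ind ∘ link (χ v))))

  -- Closed adjacency lies below `link` term by term, so a full degree leaves no room for a missing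
  -- edge.
  degree≡⇒Saturated : Respects G χ → (∀ v → suc (degree G v) ≡ reach k a c (χ v)) → Saturated G χ
  degree≡⇒Saturated resp full v w = ind-injective (sum-rigid
    (λ w → ind-mono (closed⇒link {G = G} resp v w))
    (trans (sym (suc-degree G v)) (trans (full v) (sym (sum-colours sizes (ind ∘ link (χ v)))))) w)

  private
    best : Fin n → ℚ.ℚ
    best v = ratio (pred (reach k a c (χ v))) (radius (χ v))

    sum-best : ℚΣ.sum best ≡ half (bound k a c)
    sum-best = trans (ℚΣ.sum-cong-≗ (λ v → ratio-radius (pred (reach k a c (χ v))) (χ v)))
      (trans (half-sum (weight k a c ∘ χ)) (cong half (sum-colours sizes (weight k a c))))

  module _ (resp : Respects G χ) (far : ∀ v → radius (χ v) ≤ eccentricity G v) where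

    private
      best≥ : ∀ v → ratio (degree G v) (eccentricity G v) ℚ.≤ best v
      best≥ v = ratio-mono (pred-mono-≤ (Respects⇒degree≤ resp v)) (1≤radius (χ v)) (far v)

    CEI≤bound : CEI G ℚ.≤ half (bound k a c)
    CEI≤bound = subst (CEI G ℚ.≤_) sum-best (ℚsum-mono best≥)

    -- Equal totals force every rational summand to attain its bound, and a summand that attains its
    -- bound has the largest possible degree.
    CEI≡bound⇒Saturated : CEI G ≡ half (bound k a c) → Saturated G χ
    CEI≡bound⇒Saturated eq = degree≡⇒Saturated resp λ v → trans
      (cong suc (ratio-rigid (pred-mono-≤ (Respects⇒degree≤ resp v)) (1≤radius (χ v)) (far v)
        (ℚsum-rigid best≥ (trans eq (sym sum-best)) v)))
      (suc-pred-reach v)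
      where
      -- `pred` does not truncate here: `reach` exceeds the degree and is therefore positive.
      suc-pred-reach : ∀ v → suc (pred (reach k a c (χ v))) ≡ reach k a c (χ v)
      suc-pred-reach v with reach k a c (χ v) | Respects⇒degree≤ resp v
      ... | suc _ | _ = refl

  Saturated⇒CEI≡bound : Saturated G χ → (∀ v → eccentricity G v ≡ radius (χ v)) →
                        CEI G ≡ half (bound k a c)
  Saturated⇒CEI≡bound sat ecc = trans
    (ℚΣ.sum-cong-≗ (λ v → cong₂ ratio (cong pred (Saturated⇒degree≡ sat v)) (ecc v))) sum-best

-- A vertex of one side is not adjacent to the representative of the other side, and a hub is
-- distinct from `l`.
Respects⇒radius≤ : ∀ {n} {G : Graph (Fin n)} {χ l r} → Respects G χ → χ l ≡ left → χ r ≡ right →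
                   ∀ v → radius (χ v) ≤ eccentricity G v
Respects⇒radius≤ {G = G} {χ} {l} {r} resp χl χr v with χ v in χv
... | hub   = 1≤eccentricity G {w = l} λ { refl → contradiction (trans (sym χv) χl) λ () }
... | left  = 2≤eccentricity G {w = r} (Bool.¬-not λ eq →
  contradiction (trans (sym (cong₂ link χv χr)) (closed⇒link {G = G} resp v r eq)) λ ())
... | right = 2≤eccentricity G {w = l} (Bool.¬-not λ eq →
  contradiction (trans (sym (cong₂ link χv χl)) (closed⇒link {G = G} resp v l eq)) λ ())

hub-adj : ∀ {n} {G : Graph (Fin n)} {χ h} → Saturated G χ → χ h ≡ hub → ∀ v → v ≢ h → adj G v h ≡ true
hub-adj {G = G} {χ} {h} sat χh v v≢h =
  trans (Saturated⇒adj {G = G} sat v≢h) (trans (cong (link (χ v)) χh) (link-hubʳ (χ v)))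

-- A hub reaches every vertex within one step, any other vertex within two steps through `h`.
Saturated⇒eccentricity≤ : ∀ {n} {G : Graph (Fin n)} {χ h} → Saturated G χ → χ h ≡ hub →
                          ∀ v → eccentricity G v ≤ radius (χ v)
Saturated⇒eccentricity≤ {G = G} {χ} {h} sat χh v with χ v ≟ᴾ hub
... | yes χv rewrite χv = eccentricity-≤ G near
  where
  near : ∀ w → ∃ λ l → Walk G v w l × l ≤ 1
  near w with w ≟ v
  ... | yes refl = 0 , [] , z≤n
  ... | no  w≢v  = 1 , step (trans (symmetric G v w) (hub-adj {G = G} sat χv w w≢v)) [] , ≤-refl
... | no χv≢hub = ≤-trans (eccentricity-≤ G near) (2≤radius (χ v) χv≢hub)
  where
  2≤radius : ∀ p → p ≢ hub → 2 ≤ radius p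
  2≤radius hub   p≢hub = contradiction refl p≢hub
  2≤radius left  _     = ≤-refl
  2≤radius right _     = ≤-refl
  first : adj G v h ≡ true
  first = hub-adj {G = G} sat χh v λ { refl → χv≢hub χh }
  near : ∀ w → ∃ λ l → Walk G v w l × l ≤ 2
  near w with w ≟ h
  ... | yes refl = 1 , step first [] , s≤s z≤n
  ... | no  w≢h  = 2 , step first (step (trans (symmetric G h w) (hub-adj {G = G} sat χh w w≢h)) []) , ≤-refl

-- Separating sets

Colouring : ∀ {n} → Graph (Fin n) → ℕ → Set
Colouring G s = ∃ λ χ → Respects G χ × (∃ λ l → χ l ≡ left) × (∃ λ r → χ r ≡ right) ×
  sum (is hub ∘ χ) ≡ s

-- Outside `A`, such a `B` is a union of components of `G ─ A`.
ClosedOff : ∀ {n} → Graph (Fin n) → Subset n → Subset n → Set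
ClosedOff G A B = ∀ {x y} → x ∈ B → adj G x y ≡ true → y ∉ A → y ∈ B

tint : Bool → Bool → Part
tint true  _     = hub
tint false true  = left
tint false false = right

-- The hubs are `A`, the left side is the rest of `B`, and the right side is everything else; an
-- edge between the sides would lead out of `B`.
closedOff⇒colouring : ∀ {n} {G : Graph (Fin n)} {A B u v} → ClosedOff G A B →
  u ∉ A → u ∈ B → v ∉ A → v ∉ B → Colouring G ∣ A ∣
closedOff⇒colouring {n} {G} {A} {B} {u} {v} off u∉A u∈B v∉A v∉B =
  χ , resp ,
  (u , cong₂ tint (∉⇒lookup≡false u∉A) ([]=⇒lookup u∈B)) ,
  (v , cong₂ tint (∉⇒lookup≡false v∉A) (∉⇒lookup≡false v∉B)) ,
  trans (sum-cong-≗ (λ w → is-hub-tint (Vec.lookup A w) (Vec.lookup B w))) (sym (∣p∣≡sum A))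
  where
  χ : Fin n → Part
  χ w = tint (Vec.lookup A w) (Vec.lookup B w)

  is-hub-tint : ∀ x y → is hub (tint x y) ≡ ind x
  is-hub-tint true  _     = refl
  is-hub-tint false true  = refl
  is-hub-tint false false = refl

  escape : ∀ {x y} → adj G x y ≡ true → Vec.lookup B x ≡ true →
           Vec.lookup A y ≡ false → Vec.lookup B y ≢ false
  escape {x} e Bx Ay By = lookup≡false⇒∉ By (off (lookup⇒[]= x B Bx) e (lookup≡false⇒∉ Ay))

  resp : Respects G χ
  resp x y e with Vec.lookup A x in Ax | Vec.lookup A y in Ay | Vec.lookup B x in Bx | Vec.lookup B y in By
  ... | true  | _     | _     | _     = refl
  ... | false | true  | b     | _     = link-hubʳ (tint false b)
  ... | false | false | true  | true  = refl
  ... | false | false | false | false = refl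
  ... | false | false | true  | false = contradiction By (escape e Bx Ay)
  ... | false | false | false | true  = contradiction Bx (escape (trans (symmetric G y x) e) By Ax)

-- `B` grows by one escaping vertex at a time, and well-foundedness of `_⊃_` ends the process. `P`
-- is carried as an invariant, so it may be an undecided statement about walks of every length.
close-off : ∀ {n} (G : Graph (Fin n)) (A : Subset n) (P : Fin n → Set) →
  (∀ {x y} → P x → adj G x y ≡ true → y ∉ A → P y) →
  ∀ B → (∀ {x} → x ∈ B → P x) → ∃ λ B′ → B ⊆ B′ × (∀ {x} → x ∈ B′ → P x) × ClosedOff G A B′
close-off {n} G A P spread B = go B (⊃-wellFounded B)
  where
  go : ∀ B → Acc _⊃_ B → (∀ {x} → x ∈ B → P x) →
       ∃ λ B′ → B ⊆ B′ × (∀ {x} → x ∈ B′ → P x) × ClosedOff G A B′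
  go B (acc rec) inP
    with any? (λ y → any? (λ x →
      (x ∈? B) ×-dec (adj G x y Bool.≟ true) ×-dec ¬? (y ∈? A) ×-dec ¬? (y ∈? B)))
  ... | no none = B , id , inP , λ {x} {y} x∈B e y∉A →
    decidable-stable (y ∈? B) (λ y∉B → none (y , x , x∈B , e , y∉A , y∉B))
  ... | yes (y , x , x∈B , e , y∉A , y∉B)
    with B′ , B+y⊆B′ , inP′ , off ← go (B ⊔ˢ ⁅ y ⁆)
           (rec (p⊆p∪q ⁅ y ⁆ , y , q⊆p∪q B ⁅ y ⁆ (x∈⁅x⁆ y) , y∉B))
           (λ z∈ → [ inP , (λ z∈y → subst P (sym (x∈⁅y⁆⇒x≡y y z∈y)) (spread (inP x∈B) e y∉A)) ]′
                     (x∈p∪q⁻ B ⁅ y ⁆ z∈)) =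
    B′ , B+y⊆B′ ∘ p⊆p∪q ⁅ y ⁆ , inP′ , off

∣∁p∣≡1⇒n≤1+∣p∣ : ∀ {n} (p : Subset n) → ∣ ∁ p ∣ ≡ 1 → n ≤ suc ∣ p ∣
∣∁p∣≡1⇒n≤1+∣p∣ {n} p single = begin
  n                        ≤⟨ m≤n+m∸n n ∣ p ∣ ⟩
  ∣ p ∣ + (n ∸ ∣ p ∣)      ≡⟨ cong (∣ p ∣ +_) (trans (sym (∣∁p∣≡n∸∣p∣ p)) single) ⟩
  ∣ p ∣ + 1                ≡⟨ +-comm ∣ p ∣ 1 ⟩
  suc ∣ p ∣                ∎
  where open ≤-Reasoning

-- The left side is a set closed off around `u` that misses some other vertex outside `A`. The first
-- alternative means that at most one vertex lies outside `A`.
separating⇒colouring : ∀ {n} (G : Graph (Fin n)) A → Separating G A →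
                       n ≤ suc ∣ A ∣ ⊎ Colouring G ∣ A ∣
separating⇒colouring G A (inj₂ single) = inj₁ (∣∁p∣≡1⇒n≤1+∣p∣ A single)
separating⇒colouring {n} G A (inj₁ ((u , u∉A) , (v , v∉A) , apart)) with u ≟ v
... | no u≢v = inj₂ (closedOff⇒colouring {G = G} off u∉A (⁅u⁆⊆B (x∈⁅x⁆ u)) v∉A
                      (λ v∈B → proj₂ (cut v∈B) v∉A 0 []))
  where
  Cut : Fin n → Set
  Cut x = x ∉ A × (∀ (x∉A : x ∉ A) l → ¬ Walk (G ─ A) (x , x∉A) (v , v∉A) l)

  base : ∀ {x} → x ∈ ⁅ u ⁆ → Cut x
  base x∈ rewrite x∈⁅y⁆⇒x≡y u x∈ = u∉A , λ where
    _ _ []         → u≢v refl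
    -- Adjacency in `G ─ A` ignores membership proofs, so a nonempty walk from one copy of `u` is
    -- also a walk from the copy that `apart` speaks of.
    _ _ (step e w) → apart _ (step e w)

  component : ∃ λ B → ⁅ u ⁆ ⊆ B × (∀ {x} → x ∈ B → Cut x) × ClosedOff G A B
  component = close-off G A Cut
    (λ { (x∉A , none) e y∉A → y∉A , λ y∉A′ l w → none x∉A (suc l) (step e w) }) ⁅ u ⁆ base
  ⁅u⁆⊆B = proj₁ (proj₂ component)
  cut   = proj₁ (proj₂ (proj₂ component))
  off   = proj₂ (proj₂ (proj₂ component))
-- Vertices of G ─ A carry proofs of non-membership, so u and v can be the same vertex of G
-- with two proofs not known to be equal; it is then isolated in G ─ A.
... | yes refl with any? (λ w → ¬? (w ∈? A) ×-dec (adj G u w Bool.≟ true))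
...   | yes (w , w∉A , e) =
        -- Going to the neighbour `w` and back joins the two copies of `u`.
        contradiction (step {v = w , w∉A} e (step (trans (symmetric G w u) e) [])) (apart 2)
...   | no isolated with any? (λ y → ¬? (y ∈? A) ×-dec ¬? (y ≟ u))
...     | no none = inj₁ (n≤1+∣p∣ u λ y y≢u →
            decidable-stable (y ∈? A) (λ y∉A → none (y , y∉A , y≢u)))
...     | yes (y , y∉A , y≢u) = inj₂ (closedOff⇒colouring {G = G} off u∉A (x∈⁅x⁆ u) y∉A (y≢u ∘ x∈⁅y⁆⇒x≡y u))
  where
  off : ClosedOff G A ⁅ u ⁆
  off {y = z} x∈ e z∉A rewrite x∈⁅y⁆⇒x≡y u x∈ = contradiction (z , z∉A , e) isolated

-- Every walk passes through `h`. The map `f` lets the lemma serve both `G` and `G ─ A`.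
dominated : ∀ {V n} (G : Graph (Fin n)) (f : V → Fin n) (h y : V) → f y ≢ f h →
  (∀ v → f v ≢ f h → adj G (f v) (f h) ≡ true) → Connected (pullback f G)
dominated G f h y y≢h toHub u v with f u ≟ f h | f v ≟ f h
... | no u≢h | no v≢h = _ , step {v = h} (toHub u u≢h) (step (trans (symmetric G _ _) (toHub v v≢h)) [])
... | yes eq | no v≢h = _ , step (trans (cong (λ x → adj G x (f v)) eq) (trans (symmetric G _ _) (toHub v v≢h))) []
... | no u≢h | yes eq = _ , step (trans (cong (adj G (f u)) eq) (toHub u u≢h)) []
-- Both ends lie over `f h` but may be different vertices, hence the detour through `y`.
... | yes eqᵤ | yes eqᵥ = _ ,
  step {v = y} (trans (cong (λ x → adj G x (f y)) eqᵤ) (trans (symmetric G _ _) (toHub y y≢h)))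
  (step (trans (cong (adj G (f y)) eqᵥ) (toHub y y≢h)) [])

-- Saturated graphs as members of the class

module _ {n} {G : Graph (Fin n)} {χ k a c} (sizes : HasSizes χ k a c) (sat : Saturated G χ) where

  hubs : Subset n
  hubs = Vec.tabulate (λ v → does (hub ≟ᴾ χ v))

  ∣hubs∣≡k : ∣ hubs ∣ ≡ k
  ∣hubs∣≡k = trans (∣tabulate∣≡sum (λ v → does (hub ≟ᴾ χ v))) (trans (sum-colours sizes (is hub)) (combine-hub k a c))

  ∉hubs : ∀ {v} → v ∉ hubs → χ v ≢ hub
  ∉hubs {v} v∉ χv = v∉ (lookup⇒[]= v hubs (trans (lookup∘tabulate _ v) (dec-true (hub ≟ᴾ χ v) (sym χv))))

  ≢hub⇒∉hubs : ∀ {v} → χ v ≢ hub → v ∉ hubs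
  ≢hub⇒∉hubs {v} χv = lookup≡false⇒∉ (trans (lookup∘tabulate _ v) (dec-false (hub ≟ᴾ χ v) (χv ∘ sym)))

  -- In the degenerate alternative a single vertex remains. Otherwise both sides are inhabited, and
  -- a walk that avoids the hubs cannot leave the left side.
  hubs-separating : 1 ≤ a → (c ≡ 0 × a ≡ 1) ⊎ a ≤ c → Separating G hubs
  hubs-separating _ (inj₁ (refl , refl)) = inj₂ (begin
    ∣ ∁ hubs ∣          ≡⟨ ∣∁p∣≡n∸∣p∣ hubs ⟩
    n ∸ ∣ hubs ∣        ≡⟨ cong₂ _∸_ (HasSizes⇒order sizes) ∣hubs∣≡k ⟩
    k + 1 ∸ k           ≡⟨ m+n∸m≡n k 1 ⟩
    1                   ∎)
    where open ≡-Reasoning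
  hubs-separating 1≤a (inj₂ a≤c)
    with l , χl ← left-occurs sizes 1≤a | r , χr ← right-occurs sizes (≤-trans 1≤a a≤c) =
    inj₁ ((l , nonhub χl (λ ())) , (r , nonhub χr (λ ())) , λ _ → stays χl χr)
    where
    nonhub : ∀ {v p} → χ v ≡ p → p ≢ hub → v ∉ hubs
    nonhub refl p≢hub = ≢hub⇒∉hubs p≢hub

    left-or-hub : ∀ p → link left p ≡ true → p ≢ hub → p ≡ left
    left-or-hub hub  _ p≢hub = contradiction refl p≢hub
    left-or-hub left _ _     = refl

    stays : ∀ {u v l} → χ (proj₁ u) ≡ left → χ (proj₁ v) ≡ right → ¬ Walk (G ─ hubs) u v l
    stays χu χv [] = contradiction (trans (sym χu) χv) λ ()
    stays χu χv (step {v = w , w∉hubs} e p) = stays (left-or-hub (χ w)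
      (trans (cong (λ q → link q (χ w)) (sym χu)) (Saturated⇒Respects {G = G} sat _ w e)) (∉hubs w∉hubs)) χv p

  -- If `A` misses a hub `h`, then `h` dominates what remains, so `A` separates only by leaving at
  -- most one vertex of `G`; then k < n ≤ 1 + `∣ A ∣`. Otherwise `A` contains all k hubs.
  k≤separating : 1 ≤ a → ∀ A → Separating G A → k ≤ ∣ A ∣
  k≤separating 1≤a A sep with any? (λ h → (χ h ≟ᴾ hub) ×-dec ¬? (h ∈? A))
  ... | no none = begin
    k                          ≡⟨ combine-hub k a c ⟨
    combine k a c (is hub)     ≡⟨ sum-colours sizes (is hub) ⟨
    sum (is hub ∘ χ)           ≤⟨ sum-mono (λ v → ind-mono (hub⇒∈ v)) ⟩
    sum (ind ∘ Vec.lookup A)   ≡⟨ ∣p∣≡sum A ⟨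
    ∣ A ∣                      ∎
    where
    open ≤-Reasoning
    hub⇒∈ : ∀ v → does (hub ≟ᴾ χ v) ≡ true → Vec.lookup A v ≡ true
    hub⇒∈ v eq with hub ≟ᴾ χ v
    ... | yes χv = []=⇒lookup (decidable-stable (v ∈? A) (λ v∉A → none (v , sym χv , v∉A)))
  ... | yes (h , χh , h∉A) = s≤s⁻¹ (≤-trans k<n (n≤ sep))
    where
    k<n : k < n
    k<n = subst (k <_) (sym (HasSizes⇒order sizes)) (m<m+n k (≤-trans 1≤a (m≤m+n a c)))

    n≤ : Separating G A → n ≤ suc ∣ A ∣
    n≤ (inj₂ single) = ∣∁p∣≡1⇒n≤1+∣p∣ A single
    n≤ (inj₁ (u , v , apart)) with any? (λ y → ¬? (y ∈? A) ×-dec ¬? (y ≟ h))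
    ... | no none = n≤1+∣p∣ h λ y y≢h →
      decidable-stable (y ∈? A) (λ y∉A → none (y , y∉A , y≢h))
    ... | yes (y , y∉A , y≢h) = contradiction (proj₂ walk) (apart (proj₁ walk))
      where walk = dominated G proj₁ (h , h∉A) (y , y∉A) y≢h (λ v → hub-adj {G = G} sat χh (proj₁ v)) u v

  -- Left vertices have the smallest degree when `a ≤ c`; in the degenerate alternative there is no
  -- right vertex to compare with.
  k+a≤reach : (c ≡ 0 × a ≡ 1) ⊎ a ≤ c → ∀ v → k + a ≤ reach k a c (χ v)
  k+a≤reach small v with χ v in χv
  ... | hub   = ≤-trans (m≤m+n (k + a) c) (≤-reflexive (trans (+-assoc k a c) (sym (combine-1 k a c))))
  ... | left  = ≤-reflexive (sym (reach-left k a c))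
  ... | right = ≤-trans (+-monoʳ-≤ k a≤c) (≤-reflexive (sym (reach-right k a c)))
    where
    a≤c : a ≤ c
    a≤c = [ (λ { (c≡0 , _) → contradiction (1≤right sizes χv) (<⇒≱ (s≤s (≤-reflexive c≡0))) }) , id ]′ small

  Saturated⇒𝔾 : ∀ {δ} → 1 ≤ k → 1 ≤ a → (c ≡ 0 × a ≡ 1) ⊎ a ≤ c → suc δ ≡ k + a →
                𝔾 (k + (a + c)) k δ G
  Saturated⇒𝔾 {δ} 1≤k 1≤a small sucδ
    with h , χh ← hub-occurs sizes 1≤k | l , χl ← left-occurs sizes 1≤a = record
    { order        = HasSizes⇒order sizes
    ; connected    = dominated G id h l (λ { refl → contradiction (trans (sym χh) χl) λ () })
                       (hub-adj {G = G} sat χh)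
    ; connectivity = (hubs , hubs-separating 1≤a small , ∣hubs∣≡k) ,
                     λ { _ (A , sep , refl) → k≤separating 1≤a A sep }
    ; minDegree    = δ , ((l , suc-injective (degree-l l χl)) , λ { _ (v , refl) → s≤s⁻¹ (δ< v) }) , ≤-refl
    }
    where
    degree-l : ∀ l → χ l ≡ left → suc (degree G l) ≡ suc δ
    degree-l l χl = begin
      suc (degree G l)       ≡⟨ Saturated⇒degree≡ {G = G} sizes sat l ⟩
      reach k a c (χ l)      ≡⟨ cong (reach k a c) χl ⟩
      reach k a c left       ≡⟨ reach-left k a c ⟩
      k + a                  ≡⟨ sucδ ⟨
      suc δ                  ∎
      where open ≡-Reasoning
    δ< : ∀ v → suc δ ≤ suc (degree G v)
    δ< v = subst₂ _≤_ (sym sucδ) (sym (Saturated⇒degree≡ {G = G} sizes sat v)) (k+a≤reach small v)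

-- The extremal graph

region : ∀ k a {c} → Fin (k + (a + c)) → Part
region k a = [ const hub , [ const left , const right ]′ ∘ splitAt a ]′ ∘ splitAt k

region-sizes : ∀ k a c → HasSizes (region k a {c}) k a c
region-sizes k a c = sized λ f → trans
  (sum-splitAt k (f ∘ [ const hub , [ const left , const right ]′ ∘ splitAt a ]′))
  (cong₂ _+_ (sum-const k (f hub)) (trans
    (sum-splitAt a (f ∘ [ const left , const right ]′))
    (cong₂ _+_ (sum-const a (f left)) (sum-const c (f right)))))

complete-adj : ∀ {m} {x y : Fin m} → x ≢ y → adj (complete m) x y ≡ true
complete-adj {x = x} {y} x≢y rewrite dec-false (x ≟ y) x≢y = refl

splitAt-left-≢ : ∀ m {n} {u v : Fin (m + n)} {x y} → u ≢ v →
                 splitAt m u ≡ inj₁ x → splitAt m v ≡ inj₁ y → x ≢ y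
splitAt-left-≢ m u≢v eq eq′ refl = u≢v (trans (sym (splitAt⁻¹-↑ˡ eq)) (splitAt⁻¹-↑ˡ eq′))

splitAt-right-≢ : ∀ m {n} {u v : Fin (m + n)} {x y} → u ≢ v →
                  splitAt m u ≡ inj₂ x → splitAt m v ≡ inj₂ y → x ≢ y
splitAt-right-≢ m u≢v eq eq′ refl = u≢v (trans (sym (splitAt⁻¹-↑ʳ eq)) (splitAt⁻¹-↑ʳ eq′))

region-saturated : ∀ k a c → Saturated (complete k ∨ (complete a ∪ complete c)) (region k a)
region-saturated k a c u v with u ≟ v
... | yes refl = sym (link-refl (region k a u))
... | no  u≢v with splitAt k u in eu | splitAt k v in ev
...   | inj₁ x | inj₁ y = complete-adj (splitAt-left-≢ k u≢v eu ev)
...   | inj₁ x | inj₂ y = refl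
...   | inj₂ x | inj₁ y = sym (link-hubʳ ([ const left , const right ]′ (splitAt a x)))
...   | inj₂ x | inj₂ y with splitAt a x in ex | splitAt a y in ey
...     | inj₁ _ | inj₁ _ = complete-adj (splitAt-left-≢ a (splitAt-right-≢ k u≢v eu ev) ex ey)
...     | inj₁ _ | inj₂ _ = refl
...     | inj₂ _ | inj₁ _ = refl
...     | inj₂ _ | inj₂ _ = complete-adj (splitAt-right-≢ a (splitAt-right-≢ k u≢v eu ev) ex ey)

-- The gain 2xy is added on the left, and the hubs number suc k, so that no subtraction occurs.
bound-shift : ∀ k a x y → bound (suc k) (a + x) (a + y) + 2 * (x * y) ≡ bound (suc k) a (a + (x + y))
bound-shift = solve 4 (λ k a x y →
  total k (a :+ x) (a :+ y) :+ con 2 :* (x :* y) := total k a (a :+ (x :+ y))) refl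
  where
  open +-*-Solver
  -- Mirrors the unfolding of `bound (suc k) a c`, factors 1 and 0 included, so that the solved
  -- identity is the stated one by computation.
  total : ∀ {n} → Polynomial n → Polynomial n → Polynomial n → Polynomial n
  total k a c = (con 1 :+ k) :* ((k :* con 1 :+ (a :* con 1 :+ c :* con 1)) :* con 2) :+
    (a :* ((k :* con 1 :+ (a :* con 1 :+ c :* con 0)) :* con 1) :+
     c :* ((k :* con 1 :+ (a :* con 0 :+ c :* con 1)) :* con 1))

-- Exchanging the two sides

flip : Part → Part
flip hub   = hub
flip left  = right
flip right = left

link-flip : ∀ p q → link (flip p) (flip q) ≡ link p q
link-flip hub   _     = refl
link-flip left  hub   = refl
link-flip left  left  = refl
link-flip left  right = refl
link-flip right hub   = refl
link-flip right left  = refl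
link-flip right right = refl

Saturated-flip : ∀ {n} {G : Graph (Fin n)} {χ} → Saturated G χ → Saturated G (flip ∘ χ)
Saturated-flip {χ = χ} sat u v = trans (sat u v) (sym (link-flip (χ u) (χ v)))

HasSizes-flip : ∀ {n} {χ : Fin n → Part} {k a c} → HasSizes χ k a c → HasSizes (flip ∘ χ) k c a
HasSizes-flip {k = k} {a} {c} sizes = sized λ f → trans (sum-colours sizes (f ∘ flip))
  (cong (k * f hub +_) (+-comm (a * f right) (c * f left)))

HasSizes⇒same : ∀ {m n} {χ : Fin m → Part} {η : Fin n → Part} {k a c} →
  HasSizes χ k a c → HasSizes η k a c → ∀ f → sum (f ∘ χ) ≡ sum (f ∘ η)
HasSizes⇒same sizesχ sizesη f = trans (sum-colours sizesχ f) (sym (sum-colours sizesη f))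

-- Every graph respects the all-hub colouring, so this yields the trivial degree bound and treats
-- complete graphs as saturated ones.
all-hub : ∀ n → HasSizes {n} (const hub) n 0 0
all-hub n = sized λ f → trans (sum-const n (f hub)) (sym (+-identityʳ _))

-- Consequences of membership in the class

module _ {n k δ m} {G : Graph (Fin m)} (G∈ : 𝔾 n k δ G) where
  open 𝔾 G∈

  δ≤degree : ∀ v → δ ≤ degree G v
  δ≤degree v with d , (_ , least) , δ≤d ← minDegree = ≤-trans δ≤d (least _ (v , refl))

  δ<order : suc δ ≤ n
  δ<order with d , ((v , _) , _) , _ ← minDegree = subst (suc δ ≤_) order (begin
    suc δ                      ≤⟨ s≤s (δ≤degree v) ⟩
    suc (degree G v)           ≤⟨ Respects⇒degree≤ {G = G} (all-hub m) (λ _ _ _ → refl) v ⟩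
    m * 1 + 0                  ≡⟨ trans (+-identityʳ _) (*-identityʳ m) ⟩
    m                          ∎)
    where open ≤-Reasoning

-- Minimum degree at least n - 1 makes every vertex adjacent to all others. `2 ≤ n` excludes the
-- single vertex, whose eccentricity is 0 and not `radius hub`.
𝔾-complete : ∀ {n k δ m} {G : Graph (Fin m)} → 𝔾 n k δ G → n ≤ suc δ → 2 ≤ n →
             Saturated G (const hub) × CEI G ≡ half (bound n 0 0) × HasSizes {m} (const hub) n 0 0
𝔾-complete {n} {k} {δ} {G = G} G∈ n≤1+δ 2≤n with refl ← 𝔾.order G∈ =
  sat , Saturated⇒CEI≡bound (all-hub n) sat ecc , all-hub n
  where
  full : ∀ v → suc (degree G v) ≡ reach n 0 0 hub
  full v = ≤-antisym (Respects⇒degree≤ {G = G} (all-hub n) (λ _ _ _ → refl) v)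
    (≤-trans (≤-reflexive (trans (+-identityʳ _) (*-identityʳ n)))
             (≤-trans n≤1+δ (s≤s (δ≤degree G∈ v))))
  sat : Saturated G (const hub)
  sat = degree≡⇒Saturated {G = G} (all-hub n) (λ _ _ _ → refl) full
  another : ∀ {n} → 2 ≤ n → (v : Fin n) → ∃ λ w → v ≢ w
  another {suc (suc n)} _ zero    = suc zero , λ ()
  another {suc (suc n)} _ (suc v) = zero , λ ()
  another {suc zero} (s≤s ()) _
  ecc : ∀ v → eccentricity G v ≡ 1
  ecc v = ≤-antisym (Saturated⇒eccentricity≤ {G = G} {h = v} sat refl v)
                    (1≤eccentricity G (proj₂ (another 2≤n v)))

-- A separating set of size k provides the hubs. The closed neighbourhood of a vertex of either side
-- lies within the hubs and that side, which bounds the size of the side from below.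
𝔾-colouring : ∀ {n k δ m} {G : Graph (Fin m)} → 𝔾 n k δ G → n ≤ suc k ⊎
  ∃ λ χ → Respects G χ × (∀ v → radius (χ v) ≤ eccentricity G v) ×
    ∃₂ λ b c → HasSizes χ k b c × n ≡ k + (b + c) × suc δ ≤ k + b × suc δ ≤ k + c
𝔾-colouring {n} {k} {δ} {m} {G} G∈
  with (A , sep , ∣A∣≡k) , _ ← 𝔾.connectivity G∈ | separating⇒colouring G A sep
... | inj₁ m≤1+∣A∣ rewrite sym (𝔾.order G∈) | sym ∣A∣≡k = inj₁ m≤1+∣A∣
... | inj₂ (χ , resp , (l , χl) , (r , χr) , hubs≡∣A∣) =
  inj₂ (χ , resp , Respects⇒radius≤ {G = G} resp χl χr , b , c , sizes ,
        trans (sym (𝔾.order G∈)) (HasSizes⇒order sizes) ,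
        ≤-trans (δ<reach l χl) (≤-reflexive (reach-left k b c)) ,
        ≤-trans (δ<reach r χr) (≤-reflexive (reach-right k b c)))
  where
  b = sum (is left ∘ χ)
  c = sum (is right ∘ χ)
  sizes : HasSizes χ k b c
  sizes = subst (λ s → HasSizes χ s b c) (trans hubs≡∣A∣ ∣A∣≡k) (hasSizes χ)
  δ<reach : ∀ v {p} → χ v ≡ p → suc δ ≤ reach k b c p
  δ<reach v refl = ≤-trans (s≤s (δ≤degree G∈ v)) (Respects⇒degree≤ {G = G} sizes resp v)

-- Comparison with the extremal graph

module _ {n k δ} (1≤k : 1 ≤ k) (k≤δ : k ≤ δ) (δ<n : suc δ ≤ n) where

  private
    a = suc δ ∸ k
    c = n ∸ suc δ

    k+a≡1+δ : k + a ≡ suc δ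
    k+a≡1+δ = m+[n∸m]≡n (m≤n⇒m≤1+n k≤δ)

    M-order : k + (a + c) ≡ n
    M-order = trans (sym (+-assoc k a c)) (trans (cong (_+ c) k+a≡1+δ) (m+[n∸m]≡n δ<n))

    1≤a : 1 ≤ a
    1≤a = m<n⇒0<n∸m (s≤s k≤δ)

  M∈𝔾 : (c ≡ 0 × a ≡ 1) ⊎ a ≤ c → 𝔾 n k δ (M n k δ)
  M∈𝔾 small = subst (λ N → 𝔾 N k δ (M n k δ)) M-order
    (Saturated⇒𝔾 (region-sizes k a c) (region-saturated k a c) 1≤k 1≤a small (sym k+a≡1+δ))

  -- `1 ≤ c` gives the left vertices something at distance 2; for `c` equal to 0 the graph is
  -- complete and their eccentricity is 1.
  CEI-M : 1 ≤ c → CEI (M n k δ) ≡ half (bound k a c)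
  CEI-M 1≤c
    with sizes ← region-sizes k a c | sat ← region-saturated k a c
    with h , χh ← hub-occurs sizes 1≤k | l , χl ← left-occurs sizes 1≤a
       | r , χr ← right-occurs sizes 1≤c =
    Saturated⇒CEI≡bound sizes sat λ v → ≤-antisym
      (Saturated⇒eccentricity≤ {G = M n k δ} sat χh v)
      (Respects⇒radius≤ {G = M n k δ} (Saturated⇒Respects {G = M n k δ} sat) χl χr v)

  -- The chain n ≤ k + 1 ≤ δ + 1 ≤ n collapses, so `M n k δ` and every other member of the class are
  -- complete of order n.
  M-extremal-complete : n ≤ suc k → 𝔾 n k δ (M n k δ) × (∀ m (G : Graph (Fin m)) → 𝔾 n k δ G →
    (CEI G ℚ.≤ CEI (M n k δ)) × (CEI G ≡ CEI (M n k δ) → G ≅ M n k δ))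
  M-extremal-complete n≤1+k = M∈ , λ m G G∈ →
    let satG , ceiG , sizesG = 𝔾-complete G∈ n≤1+δ 2≤n
        satM , ceiM , sizesM = 𝔾-complete M∈ n≤1+δ 2≤n
    in ℚ.≤-reflexive (trans ceiG (sym ceiM)) ,
       λ _ → Saturated⇒≅ {G = G} {H = M n k δ} satG satM (HasSizes⇒same sizesG sizesM)
    where
    n≤1+δ : n ≤ suc δ
    n≤1+δ = ≤-trans n≤1+k (s≤s k≤δ)
    2≤n : 2 ≤ n
    2≤n = ≤-trans (s≤s (≤-trans 1≤k k≤δ)) δ<n
    a≤1 : a ≤ 1
    a≤1 = ≤-trans (∸-monoˡ-≤ k (≤-trans δ<n n≤1+k)) (≤-reflexive (m+n∸n≡m 1 k))
    M∈ : 𝔾 n k δ (M n k δ)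
    M∈ = M∈𝔾 (inj₁ (m≤n⇒m∸n≡0 n≤1+δ , ≤-antisym a≤1 1≤a))

  module _ {b d} (n≡ : n ≡ k + (b + d)) (δ<k+b : suc δ ≤ k + b) (δ<k+d : suc δ ≤ k + d) where

    private
      -- The excess of each side over the least size `a`; the degree condition makes both
      -- subtractions exact.
      x = b ∸ a
      y = d ∸ a

      a≤ : ∀ {s} → suc δ ≤ k + s → a ≤ s
      a≤ {s} le = +-cancelˡ-≤ k a s (≤-trans (≤-reflexive k+a≡1+δ) le)

      b≡ : a + x ≡ b
      b≡ = m+[n∸m]≡n (a≤ δ<k+b)

      d≡ : a + y ≡ d
      d≡ = m+[n∸m]≡n (a≤ δ<k+d)

      c≡ : c ≡ a + (x + y)
      c≡ = +-cancelˡ-≡ a c (a + (x + y)) (begin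
        a + c                   ≡⟨ +-cancelˡ-≡ k (a + c) (b + d) (trans M-order n≡) ⟩
        b + d                   ≡⟨ cong₂ _+_ b≡ d≡ ⟨
        (a + x) + (a + y)       ≡⟨ solve 3 (λ a x y → (a :+ x) :+ (a :+ y) := a :+ (a :+ (x :+ y))) refl a x y ⟩
        a + (a + (x + y))       ∎)
        where
        open ≡-Reasoning
        open +-*-Solver

    a≤c : a ≤ c
    a≤c = subst (a ≤_) (sym c≡) (m≤m+n a (x + y))

    -- Moving the excess `x` to the other side gains x · y edges within the sides. Each adds 1/2 at
    -- both of its ends, and `bound` is doubled.
    bound-gap : bound k b d + 2 * (x * y) ≡ bound k a c
    bound-gap = begin
      bound k b d + 2 * (x * y)                ≡⟨ cong₂ (λ b d → bound k b d + 2 * (x * y)) b≡ d≡ ⟨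
      bound k (a + x) (a + y) + 2 * (x * y)    ≡⟨ shift 1≤k ⟩
      bound k a (a + (x + y))                  ≡⟨ cong (bound k a) c≡ ⟨
      bound k a c                              ∎
      where
      open ≡-Reasoning
      shift : ∀ {k} → 1 ≤ k → bound k (a + x) (a + y) + 2 * (x * y) ≡ bound k a (a + (x + y))
      shift {suc k} _ = bound-shift k a x y

    module _ {m} {G : Graph (Fin m)} {χ} (sizes : HasSizes χ k b d) (resp : Respects G χ)
      (far : ∀ v → radius (χ v) ≤ eccentricity G v) where

      private
        ceiM : CEI (M n k δ) ≡ half (bound k a c)
        ceiM = CEI-M (≤-trans 1≤a a≤c)

        bounds≤ : half (bound k b d) ℚ.≤ half (bound k a c)
        bounds≤ = half-mono (subst (bound k b d ≤_) bound-gap (m≤m+n _ _))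

      CEI≤CEI-M : CEI G ℚ.≤ CEI (M n k δ)
      CEI≤CEI-M = ℚ.≤-trans (CEI≤bound sizes resp far) (ℚ.≤-trans bounds≤ (ℚ.≤-reflexive (sym ceiM)))

      -- Equality holds throughout `CEI G` ≤ `half (bound k b d)` ≤ `half (bound k a c)`. The first
      -- equality makes `G` saturated, and the second makes one side have size exactly `a`.
      CEI≡CEI-M⇒≅ : CEI G ≡ CEI (M n k δ) → G ≅ M n k δ
      CEI≡CEI-M⇒≅ eq = [ fromLeft , fromRight ]′ (m*n≡0⇒m≡0∨n≡0 x xy≡0)
        where
        cei≡ : CEI G ≡ half (bound k b d)
        cei≡ = ℚ.≤-antisym (CEI≤bound sizes resp far)
          (ℚ.≤-trans bounds≤ (ℚ.≤-reflexive (sym (trans eq ceiM))))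

        sat : Saturated G χ
        sat = CEI≡bound⇒Saturated sizes resp far cei≡

        xy≡0 : x * y ≡ 0
        xy≡0 = m+n≡0⇒m≡0 (x * y) (m+n≡0⇒m≡0 (2 * (x * y)) {0} (trans (+-identityʳ _)
          (+-cancelˡ-≡ (bound k b d) _ 0 (trans bound-gap (trans
            (half-injective (trans (sym ceiM) (trans (sym eq) cei≡))) (sym (+-identityʳ _)))))))

        toM : ∀ {η} → Saturated G η → HasSizes η k a c → G ≅ M n k δ
        toM satη sizesη = Saturated⇒≅ {G = G} {H = M n k δ} satη (region-saturated k a c)
          (HasSizes⇒same sizesη (region-sizes k a c))

        fromLeft : x ≡ 0 → G ≅ M n k δ
        fromLeft x≡0 = toM sat (subst₂ (HasSizes χ k)
          (trans (sym b≡) (trans (cong (a +_) x≡0) (+-identityʳ a)))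
          (trans (sym d≡) (trans (cong (λ x → a + (x + y)) (sym x≡0)) (sym c≡))) sizes)

        fromRight : y ≡ 0 → G ≅ M n k δ
        -- Here the right side has size `a`, whereas `region` colours the clique of that size left.
        fromRight y≡0 = toM (Saturated-flip {G = G} sat) (subst₂ (HasSizes (flip ∘ χ) k)
          (trans (sym d≡) (trans (cong (a +_) y≡0) (+-identityʳ a)))
          (trans (sym b≡) (trans (cong (a +_) (sym (trans (cong (x +_) y≡0) (+-identityʳ x)))) (sym c≡)))
          (HasSizes-flip sizes))

theorem2p3 : (n k δ : ℕ) → 1 ≤ n → 1 ≤ k → 1 ≤ δ →
    k ≤ δ →
    (∃₂ λ (m : ℕ) (G : Graph (Fin m)) → 𝔾 n k δ G) →
    𝔾 n k δ (M n k δ) ×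
    (∀ (m : ℕ) (G : Graph (Fin m)) → 𝔾 n k δ G →
    (CEI G ℚ.≤ CEI (M n k δ)) ×
    (CEI G ≡ CEI (M n k δ) → G ≅ M n k δ))
-- The given member `G₀` supplies `δ < n` and, in the second case, the inequality `a ≤ c` that puts
-- `M n k δ` into the class.
theorem2p3 n k δ _ 1≤k _ k≤δ (_ , _ , G₀∈) with 𝔾-colouring G₀∈
... | inj₁ n≤1+k = M-extremal-complete 1≤k k≤δ (δ<order G₀∈) n≤1+k
... | inj₂ (_ , _ , _ , _ , _ , _ , n≡₀ , δ<b₀ , δ<d₀) =
  M∈𝔾 1≤k k≤δ δ<n (inj₂ (a≤c 1≤k k≤δ δ<n n≡₀ δ<b₀ δ<d₀)) , extremal
  where
  δ<n = δ<order G₀∈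
  extremal : ∀ m (G : Graph (Fin m)) → 𝔾 n k δ G →
    (CEI G ℚ.≤ CEI (M n k δ)) × (CEI G ≡ CEI (M n k δ) → G ≅ M n k δ)
  extremal m G G∈ with 𝔾-colouring G∈
  -- Incompatible with the two inhabited sides found for `G₀`, but the bound on n already settles
  -- the claim.
  ... | inj₁ n≤1+k = proj₂ (M-extremal-complete 1≤k k≤δ δ<n n≤1+k) m G G∈
  ... | inj₂ (_ , resp , far , _ , _ , sizes , n≡ , δ<b , δ<d) =
    CEI≤CEI-M 1≤k k≤δ δ<n n≡ δ<b δ<d sizes resp far ,
    CEI≡CEI-M⇒≅ 1≤k k≤δ δ<n n≡ δ<b δ<d sizes resp far
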